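{- Let $M$ be a natural number with $M>1$. Then a natural number $m>2$ is prime if and only if $$\prod_{j=1}^{m-1} (M^j + 1) \equiv 1 \pmod{\frac{M^m - 1}{M - 1}}.$$ -}

module Defs where

open import Data.Nat using (ℕ; zero; suc; _+_; _*_; _∸_; _^_; _<_; NonZero; >-nonZero)
open import Data.Nat.DivMod using (_/_)

prodPow : ℕ → ℕ → ℕ
prodPow M zero    = 1
prodPow M (suc k) = prodPow M k * (M ^ suc k + 1)

modulus : (M m : ℕ) → 1 < M → ℕ
modulus M m 1<M = _/_ (M ^ m ∸ 1) (M ∸ 1) {{>-nonZero (lem 1<M)}}
  where
  open import Data.Nat.Properties using (m<n⇒0<n∸m)
  lem : 1 < M → 0 < M ∸ 1
  lem = m<n⇒0<n∸m

{-# OPTIONS --safe #-}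

-- Write [k] = 1 + M + … + M^(k-1), so that the modulus is [m].  By the q-binomial theorem,
--   ∏_{j<n} (1 + c M^j) = Σ_k e(n,k) c^k,   [k] e(n,k) = [n] M^(k-1) e(n-1,k-1).
-- If D [g] divides [n] for every proper divisor g of n, then D divides e(n,k) for 0 < k < n, and
-- for odd n only the two extreme terms survive modulo D: if M^n ≡ c ≡ 1, the product is ≡ 2.
--
-- For an odd prime m = n take D = [m] and c = 1, and cancel the factor 2 coming from j = 0.
--
-- Conversely let m = q n with q the least prime factor of m, and n > 1.  If q = 2, then M^n + 1
-- divides both [m] and the product.  If q > 2, take D = Φₙ(M): cutting ∏_{j<m} (1 + M^j) into
-- q blocks of length n gives 2^q modulo D, so that the congruence would force D ∣ 2^(q-1) - 1,
-- whereas Φₙ(M) ≥ 2^(q-1) because all the prime factors of n are at least q.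

module Submission where

open import Defs
import Data.Integer.Divisibility as ℤ
open import Data.Integer.Properties using ([+m]-[+n]≡m⊖n; ⊖-≥)
open import Data.List using (List; []; _∷_)
open import Data.List.Membership.Propositional using (_∈_)
open import Data.List.Relation.Unary.All as All using (All; []; _∷_)
open import Data.List.Relation.Unary.AllPairs using (AllPairs; []; _∷_)
open import Data.List.Relation.Unary.Any using (here; there)
open import Data.Nat
open import Data.Nat.Coprimality using (Coprime; coprime-divisor; coprime-factors; coprime⇒gcd≡1)
open import Data.Nat.DivMod using (m*n/n≡m)
open import Data.Nat.Divisibility hiding (_∣?_)
open import Data.Nat.GCD
open import Data.Nat.LCM
open import Data.Nat.ListAction using (product)
open import Data.Nat.Primality
open import Data.Nat.Primality.Factorisation using (factorise; factorisationHasAllPrimeFactors)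
open import Data.Nat.Properties
open import Data.List.Membership.DecPropositional _≟_ using (_∈?_)
open import Data.Nat.Tactic.RingSolver using (solve-∀)
open import Data.Product using (∃; ∃₂; _×_; _,_; proj₁; proj₂)
open import Data.Sum using (_⊎_; inj₁; inj₂)
open import Function.Bundles using (_⇔_; mk⇔)
open import Relation.Binary.PropositionalEquality
open import Relation.Nullary using (¬_; contradiction; yes; no)

-- Repunits and their common divisors.

repunit : ℕ → ℕ → ℕ
repunit x zero    = 0
repunit x (suc n) = suc (x * repunit x n)

repunit-+ : ∀ x m n → repunit x (m + n) ≡ repunit x m + x ^ m * repunit x n
repunit-+ x zero    n = sym (+-identityʳ _)
repunit-+ x (suc m) n rewrite repunit-+ x m n = ring x (repunit x m) (x ^ m) (repunit x n)
  where
  ring : ∀ x a p b → suc (x * (a + p * b)) ≡ suc (x * a) + x * p * b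
  ring = solve-∀

repunit-∣ : ∀ x {m n} → m ∣ n → repunit x m ∣ repunit x n
repunit-∣ x {m} (divides k refl) = go k
  where
  go : ∀ k → repunit x m ∣ repunit x (k * m)
  go zero    = _ ∣0
  go (suc k) = subst (repunit x m ∣_) (sym (repunit-+ x m (k * m)))
                 (∣m∣n⇒∣m+n ∣-refl (∣n⇒∣m*n (x ^ m) (go k)))

^-via-repunit : ∀ x .{{_ : NonZero x}} n → x ^ n ≡ 1 + (x ∸ 1) * repunit x n
^-via-repunit (suc c) zero    = cong suc (sym (*-zeroʳ c))
^-via-repunit (suc c) (suc n) rewrite ^-via-repunit (suc c) n = ring c (repunit (suc c) n)
  where
  ring : ∀ c r → (1 + c) * (1 + c * r) ≡ 1 + c * suc ((1 + c) * r)
  ring = solve-∀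

^∸1-via-repunit : ∀ x .{{_ : NonZero x}} n → x ^ n ∸ 1 ≡ (x ∸ 1) * repunit x n
^∸1-via-repunit x n = cong (_∸ 1) (^-via-repunit x n)

-- One Bézout step on exponents. Splitting off the block of length `g` first leaves `repunit x g`
-- with no power of `x` in front that would have to be cancelled.
∣-repunit-difference : ∀ x {d g} u v m n → g + v * n ≡ u * m →
                       d ∣ repunit x m → d ∣ repunit x n → d ∣ repunit x g
∣-repunit-difference x {d} {g} u v m n eq d∣m d∣n = ∣m+n∣m⇒∣n
  (subst (d ∣_)
    (trans (cong (repunit x) (sym eq)) (trans (repunit-+ x g (v * n)) (+-comm (repunit x g) _)))
    (∣-trans d∣m (repunit-∣ x (n∣m*n u))))
  (∣n⇒∣m*n (x ^ g) (∣-trans d∣n (repunit-∣ x (n∣m*n v))))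

∣-repunit-gcd : ∀ x {d} m n → d ∣ repunit x m → d ∣ repunit x n → d ∣ repunit x (gcd m n)
∣-repunit-gcd x m n d∣m d∣n with Bézout.identity (gcd-GCD m n)
... | Bézout.+- u v eq = ∣-repunit-difference x u v m n eq d∣m d∣n
... | Bézout.-+ u v eq = ∣-repunit-difference x v u n m eq d∣n d∣m

-- The q-binomial expansion.

∑< : ℕ → (ℕ → ℕ) → ℕ
∑< zero    f = 0
∑< (suc n) f = ∑< n f + f n

-- The product of `1 + c * x ^ j` over `j < n`; removing the factor at `j = 0` turns `c` into
-- `c * x`.
qProduct : ℕ → ℕ → ℕ → ℕ
qProduct x c zero    = 1
qProduct x c (suc n) = (1 + c) * qProduct x (c * x) n

-- The k-th elementary symmetric polynomial in 1, x, …, x ^ (n - 1).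
esym : ℕ → ℕ → ℕ → ℕ
esym x n       zero    = 1
esym x zero    (suc k) = 0
esym x (suc n) (suc k) = x ^ suc k * esym x n (suc k) + x ^ k * esym x n k

esym-> : ∀ x {n k} → n < k → esym x n k ≡ 0
esym-> x {zero}  {suc k} _         = refl
esym-> x {suc n} {suc k} (s≤s n<k)
  rewrite esym-> x n<k | esym-> x (m<n⇒m<1+n n<k) | *-zeroʳ (x ^ k) | *-zeroʳ (x * x ^ k) = refl

^-distribʳ-* : ∀ a b n → (a * b) ^ n ≡ a ^ n * b ^ n
^-distribʳ-* a b zero    = refl
^-distribʳ-* a b (suc n) rewrite ^-distribʳ-* a b n = ring a b (a ^ n) (b ^ n)
  where
  ring : ∀ a b p q → a * b * (p * q) ≡ a * p * (b * q)
  ring = solve-∀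

-- Multiplication by `1 + c` adds to each term `c` times its predecessor; truncation leaves over
-- `c * u n`, which would belong to `v (suc n)`.
[1+c]*∑< : ∀ c (u v : ℕ → ℕ) → v 0 ≡ u 0 → (∀ k → v (suc k) ≡ u (suc k) + c * u k) →
           ∀ n → (1 + c) * ∑< (suc n) u ≡ ∑< (suc n) v + c * u n
[1+c]*∑< c u v v₀ vₛ zero    rewrite v₀ = refl
[1+c]*∑< c u v v₀ vₛ (suc n) = begin
  (1 + c) * (∑< (suc n) u + u (suc n))              ≡⟨ *-distribˡ-+ (1 + c) (∑< (suc n) u) _ ⟩
  (1 + c) * ∑< (suc n) u + (1 + c) * u (suc n)      ≡⟨ cong (_+ (1 + c) * u (suc n)) ([1+c]*∑< c u v v₀ vₛ n) ⟩
  ∑< (suc n) v + c * u n + (1 + c) * u (suc n)      ≡⟨ ring (∑< (suc n) v) c (u n) (u (suc n)) ⟩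
  ∑< (suc n) v + (u (suc n) + c * u n) + c * u (suc n)
    ≡⟨ cong (λ t → ∑< (suc n) v + t + c * u (suc n)) (vₛ n) ⟨
  ∑< (suc n) v + v (suc n) + c * u (suc n)          ∎
  where
  open ≡-Reasoning
  ring : ∀ s c a b → s + c * a + (1 + c) * b ≡ s + (b + c * a) + c * b
  ring = solve-∀

-- The numbers 1, x, ..., x^n are 1 together with x times 1, ..., x^(n-1). So the induction
-- hypothesis applies at `c * x`, and the factor `1 + c` reproduces the recursion of `esym`.
qProduct-expand : ∀ x c n → qProduct x c n ≡ ∑< (suc n) (λ k → esym x n k * c ^ k)
qProduct-expand x c zero    = refl
qProduct-expand x c (suc n) = begin
  (1 + c) * qProduct x (c * x) n  ≡⟨ cong ((1 + c) *_) (qProduct-expand x (c * x) n) ⟩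
  (1 + c) * ∑< (suc n) u          ≡⟨ [1+c]*∑< c u v refl vₛ n ⟩
  -- `esym x n (suc n)` vanishes, so the leftover `c * u n` is all of `v (suc n)`.
  ∑< (suc n) v + c * u n          ≡⟨ cong (∑< (suc n) v +_) (cong (λ z → z * (c * x) ^ suc n + c * u n) (esym-> x (n<1+n n))) ⟨
  ∑< (suc n) v + (u (suc n) + c * u n)  ≡⟨ cong (∑< (suc n) v +_) (vₛ n) ⟨
  ∑< (suc n) v + v (suc n)        ∎
  where
  open ≡-Reasoning
  u v : ℕ → ℕ
  u k = esym x n k * (c * x) ^ k
  v k = esym x (suc n) k * c ^ k
  ring : ∀ x c p q e f → (x * p * e + p * f) * (c * q) ≡ e * (c * x * (q * p)) + c * (f * (q * p))
  ring = solve-∀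
  vₛ : ∀ k → v (suc k) ≡ u (suc k) + c * u k
  vₛ k rewrite ^-distribʳ-* c x k = ring x c (x ^ k) (c ^ k) (esym x n (suc k)) (esym x n k)

-- The q-analogue of k C(n,k) = n C(n-1,k-1).
repunit*esym : ∀ x n k →
  repunit x (suc k) * esym x (suc n) (suc k) ≡ repunit x (suc n) * (x ^ k * esym x n k)
repunit*esym x zero    zero    = ring x
  where
  ring : ∀ x → suc (x * 0) * (x * 1 * 0 + 1 * 1) ≡ suc (x * 0) * (1 * 1)
  ring = solve-∀
repunit*esym x zero    (suc k) = ring (repunit x (2 + k)) (repunit x 1) (x ^ k) x
  where
  ring : ∀ a b p x → a * (x * (x * p) * 0 + x * p * 0) ≡ b * (x * p * 0)
  ring = solve-∀
repunit*esym x (suc n) zero = begin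
  repunit x 1 * (x * 1 * esym x (suc n) 1 + 1)  ≡⟨ ring x (repunit x 1) (esym x (suc n) 1) ⟩
  x * (repunit x 1 * esym x (suc n) 1) + repunit x 1 ≡⟨ cong (λ t → x * t + repunit x 1) (repunit*esym x n 0) ⟩
  x * (repunit x (suc n) * 1) + repunit x 1     ≡⟨ ring′ x (repunit x (suc n)) ⟩
  suc (x * repunit x (suc n)) * 1               ∎
  where
  open ≡-Reasoning
  ring : ∀ x a e → a * (x * 1 * e + 1) ≡ x * (a * e) + a
  ring = solve-∀
  ring′ : ∀ x a → x * (a * 1) + suc (x * 0) ≡ suc (x * a) * 1
  ring′ = solve-∀
repunit*esym x (suc n) (suc k) = begin
  suc (x * a) * (x * (x * p) * e₂ + x * p * e₁)
    -- `repunit x (2 + k)` stays whole in front of `e₂`, for the induction hypothesis at `suc k`,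
    -- and is split as `1 + x * a` in front of `e₁`, for the one at `k`.
    ≡⟨ ring x p a e₁ e₂ ⟩
  x * (x * p) * (suc (x * a) * e₂) + x * p * e₁ + x * p * x * (a * e₁)
    ≡⟨ cong₂ (λ s t → x * (x * p) * s + x * p * e₁ + x * p * x * t)
         (repunit*esym x n (suc k)) (repunit*esym x n k) ⟩
  x * (x * p) * (b * (x * p * f₁)) + x * p * e₁ + x * p * x * (b * (p * f₀))
    ≡⟨ ring′ x p b f₀ f₁ ⟩
  suc (x * b) * (x * p * e₁) ∎
  where
  open ≡-Reasoning
  p a b e₁ e₂ f₀ f₁ : ℕ
  p = x ^ k
  a = repunit x (suc k)
  b = repunit x (suc n)
  e₁ = esym x (suc n) (suc k)
  e₂ = esym x (suc n) (2 + k)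
  f₀ = esym x n k
  f₁ = esym x n (suc k)
  ring : ∀ x p a e₁ e₂ → suc (x * a) * (x * (x * p) * e₂ + x * p * e₁) ≡
         x * (x * p) * (suc (x * a) * e₂) + x * p * e₁ + x * p * x * (a * e₁)
  ring = solve-∀
  ring′ : ∀ x p b f₀ f₁ →
    x * (x * p) * (b * (x * p * f₁)) + x * p * (x * p * f₁ + p * f₀) + x * p * x * (b * (p * f₀))
    ≡ suc (x * b) * (x * p * (x * p * f₁ + p * f₀))
  ring′ = solve-∀

-- Congruences of natural numbers.

-- One-sided congruence, a ≥ r being part of the assertion.
infix 4 _≈_mod_
_≈_mod_ : ℕ → ℕ → ℕ → Set
a ≈ r mod d = ∃ λ k → a ≡ r + k * d

≈-+ : ∀ {d a b r s} → a ≈ r mod d → b ≈ s mod d → a + b ≈ r + s mod d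
≈-+ {d} {r = r} {s} (k , refl) (l , refl) = k + l , ring r s k l d
  where
  ring : ∀ r s k l d → r + k * d + (s + l * d) ≡ r + s + (k + l) * d
  ring = solve-∀

≈-* : ∀ {d a b r s} → a ≈ r mod d → b ≈ s mod d → a * b ≈ r * s mod d
≈-* {d} {r = r} {s} (k , refl) (l , refl) = r * l + k * s + k * l * d , ring r s k l d
  where
  ring : ∀ r s k l d → (r + k * d) * (s + l * d) ≡ r * s + (r * l + k * s + k * l * d) * d
  ring = solve-∀

≈-refl : ∀ {d a} → a ≈ a mod d
≈-refl = 0 , sym (+-identityʳ _)

≈1-^ : ∀ {d a} n → a ≈ 1 mod d → a ^ n ≈ 1 mod d
≈1-^ zero    a≈1 = ≈-refl
≈1-^ (suc n) a≈1 = ≈-* a≈1 (≈1-^ n a≈1)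

∑<-≈ : ∀ {d} (f : ℕ → ℕ) n → (∀ j → j < n → d ∣ f (suc j)) → ∑< (suc n) f ≈ f 0 mod d
∑<-≈ f zero    d∣f = ≈-refl
∑<-≈ {d} f (suc n) d∣f with d∣f n (n<1+n n) | ∑<-≈ f n (λ j j<n → d∣f j (m<n⇒m<1+n j<n))
... | divides l eq | k , eq′ = k + l , (begin
  ∑< (suc n) f + f (suc n)  ≡⟨ cong₂ _+_ eq′ eq ⟩
  f 0 + k * d + l * d       ≡⟨ ring (f 0) k l d ⟩
  f 0 + (k + l) * d         ∎)
  where
  open ≡-Reasoning
  ring : ∀ a k l d → a + k * d + l * d ≡ a + (k + l) * d
  ring = solve-∀

-- Coefficients modulo a primitive divisor.

-- A number theoretic substitute for "D divides Φₙ(x)".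
Primitive : ℕ → ℕ → ℕ → Set
Primitive x n D = ∀ {g} → g ∣ n → g < n → D * repunit x g ∣ repunit x n

primitive⇒∣repunit : ∀ {x n D} → 1 < n → Primitive x n D → D ∣ repunit x n
primitive⇒∣repunit {x} {n} {D} 1<n prim = m*n∣⇒m∣ D (repunit x 1) (prim (1∣ n) 1<n)

-- Let `a` be the repunit of `g`, the gcd of the two indices, and `c` the cofactor of `a` in
-- `repunit x (suc k)`. By `repunit*esym`, `D * a` divides `c * e * a`, so `D ∣ c * e`. If `i`
-- divides both `D` and `c`, then `i * a` divides both repunits, hence `a`, the repunit of their
-- gcd; so `i` is 1.
primitive⇒∣esym : ∀ {x n D} k → Primitive x (suc n) D → k < n → D ∣ esym x (suc n) (suc k)
primitive⇒∣esym {x} {n} {D} k prim k<n = coprime-divisor D⊥c D∣c*e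
  where
  g a : ℕ
  g = gcd (suc n) (suc k)
  a = repunit x g
  e = esym x (suc n) (suc k)
  g∣n : g ∣ suc n
  g∣n = gcd[m,n]∣m (suc n) (suc k)
  g∣k : g ∣ suc k
  g∣k = gcd[m,n]∣n (suc n) (suc k)
  instance
    a≢0 : NonZero a
    a≢0 with g | 0∣⇒≡0 {suc n} | g∣n
    ... | zero  | h | 0∣n = contradiction (h 0∣n) λ ()
    ... | suc _ | _ | _   = _
  D*a∣ : D * a ∣ repunit x (suc n)
  D*a∣ = prim g∣n (≤-<-trans (∣⇒≤ g∣k) (s≤s k<n))
  a∣ : a ∣ repunit x (suc k)
  a∣ = repunit-∣ x g∣k
  c : ℕ
  c = quotient a∣
  D*a∣c*e*a : D * a ∣ c * e * a
  D*a∣c*e*a = subst (D * a ∣_)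
    (trans (sym (repunit*esym x n k))
      (trans (cong (_* e) (m∣n⇒n≡quotient*m a∣)) (ring c a e)))
    (∣m⇒∣m*n (x ^ k * esym x n k) D*a∣)
    where
    ring : ∀ c a e → c * a * e ≡ c * e * a
    ring = solve-∀
  D∣c*e : D ∣ c * e
  D∣c*e = *-cancelʳ-∣ a D*a∣c*e*a
  D⊥c : Coprime D c
  D⊥c {i} (i∣D , i∣c) = ∣1⇒≡1 (*-cancelʳ-∣ a (subst (i * a ∣_) (sym (*-identityˡ a))
    (∣-repunit-gcd x (suc n) (suc k)
      (∣-trans (*-monoˡ-∣ a i∣D) D*a∣)
      (subst (i * a ∣_) (sym (m∣n⇒n≡quotient*m a∣)) (*-monoˡ-∣ a i∣c)))))

-- Odd length: parity, the top coefficient and the whole product.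

2∣n*[1+n] : ∀ n → 2 ∣ n * (1 + n)
2∣n*[1+n] zero    = 2 ∣0
2∣n*[1+n] (suc n) = subst (2 ∣_) (ring n) (∣m∣n⇒∣m+n (2∣n*[1+n] n) (m∣m*n (1 + n)))
  where
  ring : ∀ n → n * (1 + n) + 2 * (1 + n) ≡ suc n * (1 + suc n)
  ring = solve-∀

-- The sum x + x^2 + ... + x^(2h) pairs off into multiples of x (1 + x).
2∣x*repunit : ∀ x h → 2 ∣ x * repunit x (h * 2)
2∣x*repunit x zero    = subst (2 ∣_) (sym (*-zeroʳ x)) (2 ∣0)
2∣x*repunit x (suc h) = subst (2 ∣_) (ring x (repunit x (h * 2)))
  (∣m∣n⇒∣m+n (2∣n*[1+n] x) (∣n⇒∣m*n (x * x) (2∣x*repunit x h)))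
  where
  ring : ∀ x r → x * (1 + x) + x * x * (x * r) ≡ x * suc (x * suc (x * r))
  ring = solve-∀

repunit-odd : ∀ x h → ¬ 2 ∣ repunit x (1 + h * 2)
repunit-odd x h 2∣ =
  contradiction (∣1⇒≡1 (∣m+n∣m⇒∣n (subst (2 ∣_) (+-comm 1 _) 2∣) (2∣x*repunit x h))) λ ()

∤2⇒coprime-2 : ∀ {d} → ¬ 2 ∣ d → Coprime d 2
∤2⇒coprime-2 2∤d {i} (i∣d , i∣2) with irreducible[2] i∣2
... | inj₁ i≡1  = i≡1
... | inj₂ refl = contradiction i∣d 2∤d

-- Equals n (n - 1) / 2, the exponent of the product of 1, x, ..., x^(n-1).
triangular : ℕ → ℕ
triangular zero    = 0
triangular (suc n) = n + triangular n

-- For odd `n` the exponent of the top coefficient is a multiple of `n`, so that coefficient is a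
-- power of `x ^ n` and thus 1 modulo `D`.
triangular-odd : ∀ h → triangular (1 + h * 2) ≡ (1 + h * 2) * h
triangular-odd zero    = refl
triangular-odd (suc h) = trans (cong (λ t → 2 + h * 2 + (1 + h * 2 + t)) (triangular-odd h)) (ring h)
  where
  ring : ∀ h → 2 + h * 2 + (1 + h * 2 + (1 + h * 2) * h) ≡ (1 + suc h * 2) * suc h
  ring = solve-∀

esym-diagonal : ∀ x n → esym x n n ≡ x ^ triangular n
esym-diagonal x zero    = refl
esym-diagonal x (suc n) rewrite esym-> x (n<1+n n) | *-zeroʳ (x * x ^ n) | esym-diagonal x n =
  sym (^-distribˡ-+-* x n (triangular n))

module _ {x D h : ℕ} .{{_ : NonZero x}} (1<n : 1 < 1 + h * 2) (prim : Primitive x (1 + h * 2) D) where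

  private
    n : ℕ
    n = 1 + h * 2

  primitive-odd : Coprime D 2
  primitive-odd = ∤2⇒coprime-2 λ 2∣D → repunit-odd x h (∣-trans 2∣D (primitive⇒∣repunit 1<n prim))

  x^n≈1 : x ^ n ≈ 1 mod D
  x^n≈1 with primitive⇒∣repunit 1<n prim
  ... | divides k eq = (x ∸ 1) * k ,
    trans (^-via-repunit x n) (cong suc (trans (cong ((x ∸ 1) *_) eq) (sym (*-assoc (x ∸ 1) k D))))

  -- All the intermediate coefficients esym x n k vanish modulo D.
  qProduct≈2 : ∀ {c} → c ≈ 1 mod D → qProduct x c n ≈ 2 mod D
  qProduct≈2 {c} c≈1 = subst (_≈ 2 mod D) (sym (qProduct-expand x c n))
    (≈-+ (∑<-≈ (λ k → esym x n k * c ^ k) (h * 2)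
            (λ j j<n → ∣m⇒∣m*n (c ^ suc j) (primitive⇒∣esym j prim j<n)))
         (≈-* diagonal≈1 (≈1-^ n c≈1)))
    where
    diagonal≈1 : esym x n n ≈ 1 mod D
    diagonal≈1 = subst (_≈ 1 mod D)
      (trans (^-*-assoc x n h) (trans (cong (x ^_) (sym (triangular-odd h))) (sym (esym-diagonal x n))))
      (≈1-^ h x^n≈1)

-- Cutting the product into blocks.

qProduct-+ : ∀ x c m n → qProduct x c (m + n) ≡ qProduct x c m * qProduct x (c * x ^ m) n
qProduct-+ x c zero    n rewrite *-identityʳ c = sym (+-identityʳ _)
qProduct-+ x c (suc m) n rewrite qProduct-+ x (c * x) m n | *-assoc c x (x ^ m) =
  sym (*-assoc (1 + c) (qProduct x (c * x) m) _)

qProduct≡2*prodPow : ∀ x n → qProduct x 1 (suc n) ≡ 2 * prodPow x n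
qProduct≡2*prodPow x zero    = refl
qProduct≡2*prodPow x (suc n) = begin
  -- `qProduct` unfolds at its first factor but `prodPow` at its last, so the last factor is split
  -- off as a block of length one.
  qProduct x 1 (2 + n)                              ≡⟨ cong (qProduct x 1) (+-comm 1 (suc n)) ⟩
  qProduct x 1 (suc n + 1)                          ≡⟨ qProduct-+ x 1 (suc n) 1 ⟩
  qProduct x 1 (suc n) * ((1 + 1 * x ^ suc n) * 1)  ≡⟨ cong (_* ((1 + 1 * x ^ suc n) * 1)) (qProduct≡2*prodPow x n) ⟩
  2 * prodPow x n * ((1 + 1 * x ^ suc n) * 1)       ≡⟨ ring (prodPow x n) (x ^ suc n) ⟩
  2 * (prodPow x n * (x ^ suc n + 1))               ∎
  where
  open ≡-Reasoning
  ring : ∀ p y → 2 * p * ((1 + 1 * y) * 1) ≡ 2 * (p * (y + 1))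
  ring = solve-∀

-- Each new block starts at `c` times a power of `x ^ n`, where `n = 1 + h * 2`. This is still 1
-- modulo `D`, so every block contributes a factor 2.
qProduct≈2^ : ∀ {x D h} .{{_ : NonZero x}} → 1 < 1 + h * 2 → Primitive x (1 + h * 2) D →
              ∀ q {c} → c ≈ 1 mod D → qProduct x c (q * (1 + h * 2)) ≈ 2 ^ q mod D
qProduct≈2^ 1<n prim zero    c≈1 = ≈-refl
qProduct≈2^ {x} {D} {h} 1<n prim (suc q) {c} c≈1 =
  subst (_≈ 2 ^ suc q mod D) (sym (qProduct-+ x c (1 + h * 2) (q * (1 + h * 2))))
    (≈-* (qProduct≈2 {h = h} 1<n prim c≈1)
         (qProduct≈2^ {h = h} 1<n prim q (≈-* c≈1 (x^n≈1 {h = h} 1<n prim))))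

prodPow>0 : ∀ x n → 0 < prodPow x n
prodPow>0 x zero    = s≤s z≤n
prodPow>0 x (suc n) = *-mono-≤ (prodPow>0 x n) (m≤n+m 1 (x ^ suc n))

primitive⇒∣prodPow∸1 : ∀ {x D h} .{{_ : NonZero x}} → 1 < 1 + h * 2 → Primitive x (1 + h * 2) D →
                       D ∣ prodPow x (h * 2) ∸ 1
primitive⇒∣prodPow∸1 {x} {D} {h} 1<n prim
  with prodPow x (h * 2) | prodPow>0 x (h * 2) | qProduct≡2*prodPow x (h * 2)
     | qProduct≈2 {h = h} 1<n prim ≈-refl
... | suc p | _ | eq | k , eq′ = coprime-divisor (primitive-odd {h = h} 1<n prim)
  (divides k (+-cancelˡ-≡ 2 (2 * p) (k * D) (trans (ring p) (trans (sym eq) eq′))))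
  where
  ring : ∀ p → 2 + 2 * p ≡ 2 * suc p
  ring = solve-∀

-- There are `suc q` blocks; one of their factors 2 cancels against the factor at `j = 0`, which
-- leaves `2 ^ q`.
primitive⇒∣2^∸1 : ∀ {x D h} .{{_ : NonZero x}} → 1 < 1 + h * 2 → Primitive x (1 + h * 2) D →
  ∀ q m → suc m ≡ suc q * (1 + h * 2) → D ∣ prodPow x m ∸ 1 → D ∣ 2 ^ q ∸ 1
primitive⇒∣2^∸1 {x} {D} {h} 1<n prim q m eq D∣
  with prodPow x m | prodPow>0 x m | qProduct≡2*prodPow x m
     | qProduct≈2^ {h = h} 1<n prim (suc q) ≈-refl | D∣
... | suc p | _ | eq₁ | k , eq₂ | D∣p with 2 ^ q | m^n>0 2 q
... | suc t | _ = coprime-divisor (primitive-odd {h = h} 1<n prim)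
  (∣m+n∣m⇒∣n (subst (D ∣_) eq₃ (∣n⇒∣m*n 2 D∣p)) (n∣m*n k))
  where
  eq₃ : 2 * p ≡ k * D + 2 * t
  eq₃ = +-cancelˡ-≡ 2 _ _ (trans (ring p) (trans (trans (sym eq₁) (trans (cong (qProduct x 1) eq) eq₂)) (ring′ t k D)))
    where
    ring : ∀ p → 2 + 2 * p ≡ 2 * suc p
    ring = solve-∀
    ring′ : ∀ t k D → 2 * suc t + k * D ≡ 2 + (k * D + 2 * t)
    ring′ = solve-∀

-- Gcd and lcm of numbers of the form x^n - 1.

-- Distributivity of gcd over lcm.
∣lcm⇒∣ : ∀ {t u} a b .{{_ : NonZero a}} →
         t ∣ lcm a b → gcd t a ∣ u → gcd t b ∣ u → t ∣ u
∣lcm⇒∣ {t} {u} a b t∣lcm t,a∣u t,b∣u =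
  -- The lcm is both `a′ * b` and `b′ * a`. From `t ∣ c * d` follows that `t` divides `c * gcd t d`,
  -- hence `c * u`; the two cofactors `a′` and `b′` are coprime.
  coprime-factors a′⊥b′ (∣cofactor a′ b lcm≡a′*b t,b∣u , ∣cofactor b′ a lcm≡b′*a t,a∣u)
  where
  g : ℕ
  g = gcd a b
  a≡ : a ≡ quotient (gcd[m,n]∣m a b) * g
  a≡ = m∣n⇒n≡quotient*m (gcd[m,n]∣m a b)
  b≡ : b ≡ quotient (gcd[m,n]∣n a b) * g
  b≡ = m∣n⇒n≡quotient*m (gcd[m,n]∣n a b)
  a′ b′ : ℕ
  a′ = quotient (gcd[m,n]∣m a b)
  b′ = quotient (gcd[m,n]∣n a b)
  instance
    g≢0 : NonZero g
    g≢0 = ≢-nonZero (gcd[m,n]≢0 a b (inj₁ (≢-nonZero⁻¹ a)))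
  lcm≡a′*b : lcm a b ≡ a′ * b
  lcm≡a′*b = *-cancelˡ-≡ _ _ g (trans (gcd*lcm a b) (trans (cong (_* b) a≡) (ring a′ g b)))
    where
    ring : ∀ a g b → a * g * b ≡ g * (a * b)
    ring = solve-∀
  lcm≡b′*a : lcm a b ≡ b′ * a
  lcm≡b′*a = *-cancelˡ-≡ _ _ g (trans (gcd*lcm a b) (trans (cong (a *_) b≡) (ring b′ g a)))
    where
    ring : ∀ b g a → a * (b * g) ≡ g * (b * a)
    ring = solve-∀
  a′⊥b′ : Coprime a′ b′
  a′⊥b′ {i} (i∣a′ , i∣b′) = ∣1⇒≡1 (*-cancelʳ-∣ g (subst (i * g ∣_) (sym (*-identityˡ g))
    (gcd-greatest (subst (i * g ∣_) (sym a≡) (*-monoˡ-∣ g i∣a′))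
                  (subst (i * g ∣_) (sym b≡) (*-monoˡ-∣ g i∣b′)))))
  ∣cofactor : ∀ c d → lcm a b ≡ c * d → gcd t d ∣ u → t ∣ c * u
  ∣cofactor c d eq t,d∣u = ∣-trans
    (subst (t ∣_) (sym (c*gcd[m,n]≡gcd[cm,cn] c t d))
      (gcd-greatest (n∣m*n c) (subst (t ∣_) eq t∣lcm)))
    (*-monoʳ-∣ c t,d∣u)

^∸1-∣ : ∀ x .{{_ : NonZero x}} {m n} → m ∣ n → x ^ m ∸ 1 ∣ x ^ n ∸ 1
^∸1-∣ x {m} {n} m∣n = subst₂ _∣_ (sym (^∸1-via-repunit x m)) (sym (^∸1-via-repunit x n))
  (*-monoʳ-∣ (x ∸ 1) (repunit-∣ x m∣n))

-- Both numbers are `x ∸ 1` times a repunit, and repunits of coprime lengths are coprime.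
∣^∸1-coprime : ∀ x .{{_ : NonZero x}} {d m n} → Coprime m n →
               d ∣ x ^ m ∸ 1 → d ∣ x ^ n ∸ 1 → d ∣ x ∸ 1
∣^∸1-coprime x {d} {m} {n} m⊥n d∣m d∣n = subst (d ∣_)
  (trans (sym (c*gcd[m,n]≡gcd[cm,cn] (x ∸ 1) _ _)) (trans (cong ((x ∸ 1) *_) gcd≡1) (*-identityʳ _)))
  (gcd-greatest (subst (d ∣_) (^∸1-via-repunit x m) d∣m) (subst (d ∣_) (^∸1-via-repunit x n) d∣n))
  where
  gcd≡1 : gcd (repunit x m) (repunit x n) ≡ 1
  gcd≡1 = ∣1⇒≡1 (subst (gcd (repunit x m) (repunit x n) ∣_)
    (trans (cong (repunit x) (coprime⇒gcd≡1 m⊥n)) (cong suc (*-zeroʳ x)))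
    (∣-repunit-gcd x m n (gcd[m,n]∣m (repunit x m) _) (gcd[m,n]∣n (repunit x m) _)))

^-swap : ∀ y r s → (y ^ r) ^ s ≡ (y ^ s) ^ r
^-swap y r s = trans (^-*-assoc y r s) (trans (cong (y ^_) (*-comm r s)) (sym (^-*-assoc y s r)))

-- With N = product S, this is the least common multiple of the y ^ (N / r) ∸ 1 for r ∈ S.
powLcm : List ℕ → ℕ → ℕ
powLcm []      y = 1
powLcm (s ∷ S) y = lcm (powLcm S (y ^ s)) (y ^ product S ∸ 1)

powLcm-∣ : ∀ S y .{{_ : NonZero y}} → powLcm S y ∣ y ^ product S ∸ 1
powLcm-∣ []      y = 1∣ _
powLcm-∣ (s ∷ S) y = lcm-least
  (subst (λ z → powLcm S (y ^ s) ∣ z ∸ 1) (^-*-assoc y s (product S))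
    (powLcm-∣ S (y ^ s) {{m^n≢0 y s}}))
  (^∸1-∣ y (n∣m*n s))

∈⇒∣powLcm : ∀ {r S} y → r ∈ S → ∃ λ e → product S ≡ r * e × y ^ e ∸ 1 ∣ powLcm S y
∈⇒∣powLcm {S = s ∷ S} y (here refl) =
  product S , refl , n∣lcm[m,n] (powLcm S (y ^ s)) (y ^ product S ∸ 1)
∈⇒∣powLcm {r} {s ∷ S} y (there r∈S) with ∈⇒∣powLcm (y ^ s) r∈S
... | e , eq , ∣powLcm = s * e , trans (cong (s *_) eq) (ring r s e) ,
  ∣-trans (subst (λ z → z ∸ 1 ∣ powLcm S (y ^ s)) (^-*-assoc y s e) ∣powLcm)
          (m∣lcm[m,n] (powLcm S (y ^ s)) _)
  where
  ring : ∀ r s e → s * (r * e) ≡ r * (s * e)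
  ring = solve-∀

powLcm-^ : ∀ S y .{{_ : NonZero y}} t → powLcm S y ∣ powLcm S (y ^ t)
powLcm-^ []      y t = ∣-refl
powLcm-^ (s ∷ S) y t = lcm-least
  (∣-trans (powLcm-^ S (y ^ s) {{m^n≢0 y s}} t)
    (subst (λ z → powLcm S z ∣ powLcm (s ∷ S) (y ^ t)) (^-swap y t s) (m∣lcm[m,n] (powLcm S ((y ^ t) ^ s)) _)))
  (∣-trans (subst (λ z → y ^ product S ∸ 1 ∣ z ∸ 1) (sym (^-*-assoc y t (product S))) (^∸1-∣ y (n∣m*n t)))
    (n∣lcm[m,n] (powLcm S ((y ^ t) ^ s)) _))

1<⇒nonZero : ∀ {y} → 1 < y → NonZero y
1<⇒nonZero 1<y = >-nonZero (<-trans z<s 1<y)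

1<^ : ∀ {y} s .{{_ : NonZero s}} → 1 < y → 1 < y ^ s
1<^ {y} s 1<y = subst (_< y ^ s) (^-zeroˡ s) (^-monoˡ-< s 1<y)

^∸1-nonZero : ∀ {y} n .{{_ : NonZero n}} → 1 < y → NonZero (y ^ n ∸ 1)
^∸1-nonZero n 1<y = >-nonZero (m<n⇒0<n∸m (1<^ n 1<y))

product-nonZero : ∀ {S} → All NonZero S → NonZero (product S)
product-nonZero []                  = _
product-nonZero {s ∷ S} (s≢0 ∷ S≢0) = m*n≢0 s (product S) {{s≢0}} {{product-nonZero S≢0}}

powLcm-nonZero : ∀ {S y} → All NonZero S → 1 < y → NonZero (powLcm S y)
powLcm-nonZero {S} {y} S≢0 1<y = ≢-nonZero λ L≡0 →
  ≢-nonZero⁻¹ _ {{^∸1-nonZero (product S) {{product-nonZero S≢0}} 1<y}}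
    (0∣⇒≡0 (subst (_∣ y ^ product S ∸ 1) L≡0 (powLcm-∣ S y {{1<⇒nonZero 1<y}})))

-- Serves to identify a gcd in `cyclo-∷`. By `∣lcm⇒∣` it suffices to treat the gcds of `d` with the
-- two arguments of the lcm. The first falls to induction at `y ^ r`. With N the product of the
-- tail, the second divides (y^N)^s - 1 and (y^N)^r - 1, hence y^N - 1, as s and r are coprime.
∣powLcm : ∀ {S y d s} .{{_ : NonZero s}} → All NonZero S → All (Coprime s) S → 1 < y →
          d ∣ powLcm S (y ^ s) → d ∣ y ^ product S ∸ 1 → d ∣ powLcm S y
∣powLcm []          []          1<y d∣L d∣N = d∣L
∣powLcm {r ∷ S} {y} {d} {s} (r≢0 ∷ S≢0) (s⊥r ∷ s⊥S) 1<y d∣L d∣N =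
  ∣lcm⇒∣ A B {{powLcm-nonZero S≢0 (1<^ r {{r≢0}} (1<^ s 1<y))}} d∣L
    (∣-trans
      (∣powLcm S≢0 s⊥S (1<^ r {{r≢0}} 1<y)
        (subst (λ z → gcd d A ∣ powLcm S z) (^-swap y s r) (gcd[m,n]∣n d A))
        (∣-trans (gcd[m,n]∣m d A) (subst (λ z → d ∣ z ∸ 1) (sym (^-*-assoc y r (product S))) d∣N)))
      (m∣lcm[m,n] (powLcm S (y ^ r)) _))
    (∣-trans
      (∣^∸1-coprime (y ^ product S) {{m^n≢0 y (product S) {{y≢0}}}} s⊥r
        (subst (λ z → gcd d B ∣ z ∸ 1) (^-swap y s (product S)) (gcd[m,n]∣n d B))
        (∣-trans (gcd[m,n]∣m d B)
          (subst (λ z → d ∣ z ∸ 1) (trans (sym (^-*-assoc y r (product S))) (^-swap y r (product S))) d∣N)))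
      (n∣lcm[m,n] (powLcm S (y ^ r)) _))
  where
  y≢0 : NonZero y
  y≢0 = 1<⇒nonZero 1<y
  A B : ℕ
  A = powLcm S ((y ^ s) ^ r)
  B = (y ^ s) ^ product S ∸ 1

-- Cyclotomic values.

-- The value Φ_N(y) of the cyclotomic polynomial of the product N of the distinct primes in S.
cyclo : (S : List ℕ) (y : ℕ) .{{_ : NonZero y}} → ℕ
cyclo S y = quotient (powLcm-∣ S y)

cyclo*powLcm : ∀ S y .{{_ : NonZero y}} → y ^ product S ∸ 1 ≡ cyclo S y * powLcm S y
cyclo*powLcm S y = m∣n⇒n≡quotient*m (powLcm-∣ S y)

-- The identity Φ_{sN}(y) Φ_N(y) = Φ_N(y^s). The gcd of `A` and `B` is `powLcm S y`, so their lcm is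
-- `A * cyclo S y`; both sides times `A` then equal y^(sN) - 1.
cyclo-∷ : ∀ {s S y} .{{_ : NonZero y}} (s≢0 : NonZero s) → All NonZero S → All (Coprime s) S → 1 < y →
          cyclo (s ∷ S) y * cyclo S y ≡ cyclo S (y ^ s) {{m^n≢0 y s}}
cyclo-∷ {s} {S} {y} s≢0 S≢0 s⊥S 1<y =
  *-cancelʳ-≡ _ _ A (begin
    cyclo (s ∷ S) y * cyclo S y * A      ≡⟨ ring (cyclo (s ∷ S) y) (cyclo S y) A ⟩
    cyclo (s ∷ S) y * (A * cyclo S y)    ≡⟨ cong (cyclo (s ∷ S) y *_) powLcm-∷ ⟨
    cyclo (s ∷ S) y * powLcm (s ∷ S) y   ≡⟨ cyclo*powLcm (s ∷ S) y ⟨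
    y ^ (s * product S) ∸ 1              ≡⟨ cong (_∸ 1) (^-*-assoc y s (product S)) ⟨
    (y ^ s) ^ product S ∸ 1              ≡⟨ cyclo*powLcm S (y ^ s) {{m^n≢0 y s}} ⟩
    cyclo S (y ^ s) {{m^n≢0 y s}} * A    ∎)
  where
  open ≡-Reasoning
  A B : ℕ
  A = powLcm S (y ^ s)
  B = y ^ product S ∸ 1
  instance
    _ = s≢0
    L≢0 : NonZero (powLcm S y)
    L≢0 = powLcm-nonZero S≢0 1<y
    A≢0 : NonZero A
    A≢0 = powLcm-nonZero S≢0 (1<^ s 1<y)
  ring : ∀ a b c → a * b * c ≡ a * (c * b)
  ring = solve-∀
  gcd≡ : gcd A B ≡ powLcm S y
  gcd≡ = ∣-antisym (∣powLcm S≢0 s⊥S 1<y (gcd[m,n]∣m A B) (gcd[m,n]∣n A B))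
                   (gcd-greatest (powLcm-^ S y s) (powLcm-∣ S y))
  powLcm-∷ : powLcm (s ∷ S) y ≡ A * cyclo S y
  powLcm-∷ = *-cancelˡ-≡ _ _ (powLcm S y) (begin
    powLcm S y * lcm A B            ≡⟨ cong (_* lcm A B) gcd≡ ⟨
    gcd A B * lcm A B               ≡⟨ gcd*lcm A B ⟩
    A * B                           ≡⟨ cong (A *_) (cyclo*powLcm S y) ⟩
    A * (cyclo S y * powLcm S y)    ≡⟨ ring′ A (cyclo S y) (powLcm S y) ⟩
    powLcm S y * (A * cyclo S y)    ∎)
    where
    ring′ : ∀ a b c → a * (b * c) ≡ c * (a * b)
    ring′ = solve-∀

cyclo-[s] : ∀ {s y} .{{_ : NonZero y}} (s≢0 : NonZero s) → 1 < y → cyclo (s ∷ []) y ≡ repunit y s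
cyclo-[s] {s} {y} s≢0 1<y = *-cancelʳ-≡ _ _ (y ∸ 1) {{>-nonZero (m<n⇒0<n∸m 1<y)}} (begin
  cyclo (s ∷ []) y * (y ∸ 1)         ≡⟨ cong (cyclo (s ∷ []) y *_) (cyclo-[] y) ⟨
  cyclo (s ∷ []) y * cyclo [] y      ≡⟨ cyclo-∷ s≢0 [] [] 1<y ⟩
  cyclo [] (y ^ s) {{m^n≢0 y s}}     ≡⟨ cyclo-[] (y ^ s) {{m^n≢0 y s}} ⟩
  y ^ s ∸ 1                          ≡⟨ ^∸1-via-repunit y s ⟩
  (y ∸ 1) * repunit y s              ≡⟨ *-comm (y ∸ 1) _ ⟩
  repunit y s * (y ∸ 1)              ∎)
  where
  open ≡-Reasoning
  cyclo-[] : ∀ y .{{_ : NonZero y}} → cyclo [] y ≡ y ∸ 1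
  cyclo-[] y = trans (sym (*-identityʳ _)) (trans (sym (cyclo*powLcm [] y)) (cong (_∸ 1) (*-identityʳ y)))

-- The size of cyclotomic values.

repunit-lower : ∀ y t → y ^ t ≤ repunit y (suc t)
repunit-lower y zero    = s≤s z≤n
repunit-lower y (suc t) = m≤n⇒m≤1+n (*-monoʳ-≤ y (repunit-lower y t))

repunit-upper : ∀ {y} → 1 < y → ∀ t → repunit y (suc t) < 2 * y ^ t
repunit-upper {y} 1<y zero    = ≤-reflexive (cong (2 +_) (*-zeroʳ y))
repunit-upper {y} 1<y (suc t) = begin-strict
  1 + y * repunit y (suc t)      <⟨ +-monoˡ-< (y * repunit y (suc t)) 1<y ⟩
  y + y * repunit y (suc t)      ≡⟨ *-suc y _ ⟨
  y * suc (repunit y (suc t))    ≤⟨ *-monoʳ-≤ y (repunit-upper 1<y t) ⟩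
  y * (2 * y ^ t)                ≡⟨ ring y (y ^ t) ⟩
  2 * (y * y ^ t)                ∎
  where
  open ≤-Reasoning
  ring : ∀ y p → y * (2 * p) ≡ 2 * (y * p)
  ring = solve-∀

-- Compares `cyclo S y` with its leading term. Both sides are kept, uniformly in `y`, because the
-- next value is the quotient of `cyclo S (y ^ s)` by `cyclo S y`.
record Bounds (S : List ℕ) (φ α β : ℕ) : Set where
  field
    lower : ∀ y .{{_ : NonZero y}} → 1 < y → y ^ φ ≤ 2 ^ α * cyclo S y
    upper : ∀ y .{{_ : NonZero y}} → 1 < y → cyclo S y ≤ 2 ^ β * y ^ φ

bounds-[s] : ∀ t → Bounds (suc t ∷ []) t 0 1
bounds-[s] t = record
  { lower = λ y 1<y → ≤-trans (repunit-lower y t)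
      (≤-reflexive (trans (sym (cyclo-[s] _ 1<y)) (sym (+-identityʳ _))))
  ; upper = λ y 1<y → ≤-trans (≤-reflexive (cyclo-[s] _ 1<y)) (<⇒≤ (repunit-upper 1<y t))
  }

-- In the quotient given by `cyclo-∷`, numerator and denominator are bounded from opposite sides, so
-- the losses `α` and `β` add up in both directions, and the exponent is `suc t * φ` less `φ`.
bounds-∷ : ∀ {t S φ α β} → All NonZero S → All (Coprime (suc t)) S → Bounds S φ α β →
           Bounds (suc t ∷ S) (t * φ) (α + β) (α + β)
bounds-∷ {t} {S} {φ} {α} {β} S≢0 s⊥S bounds = record { lower = lower′ ; upper = upper′ }
  where
  open Bounds bounds
  open ≤-Reasoning
  s : ℕ
  s = suc t
  ^-split : ∀ y → (y ^ s) ^ φ ≡ y ^ φ * y ^ (t * φ)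
  ^-split y = trans (^-*-assoc y s φ) (^-distribˡ-+-* y φ (t * φ))
  lower′ : ∀ y .{{_ : NonZero y}} → 1 < y → y ^ (t * φ) ≤ 2 ^ (α + β) * cyclo (s ∷ S) y
  lower′ y 1<y = *-cancelˡ-≤ (y ^ φ) {{m^n≢0 y φ}} (begin
    y ^ φ * y ^ (t * φ)                                ≡⟨ ^-split y ⟨
    (y ^ s) ^ φ                                        ≤⟨ lower (y ^ s) {{m^n≢0 y s}} (1<^ s 1<y) ⟩
    2 ^ α * cyclo S (y ^ s) {{m^n≢0 y s}}              ≡⟨ cong (2 ^ α *_) (cyclo-∷ _ S≢0 s⊥S 1<y) ⟨
    2 ^ α * (cyclo (s ∷ S) y * cyclo S y)              ≤⟨ *-monoʳ-≤ (2 ^ α) (*-monoʳ-≤ (cyclo (s ∷ S) y) (upper y 1<y)) ⟩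
    2 ^ α * (cyclo (s ∷ S) y * (2 ^ β * y ^ φ))        ≡⟨ ring (2 ^ α) (2 ^ β) (cyclo (s ∷ S) y) (y ^ φ) ⟩
    y ^ φ * (2 ^ α * 2 ^ β * cyclo (s ∷ S) y)          ≡⟨ cong (λ z → y ^ φ * (z * cyclo (s ∷ S) y)) (^-distribˡ-+-* 2 α β) ⟨
    y ^ φ * (2 ^ (α + β) * cyclo (s ∷ S) y)            ∎)
    where
    ring : ∀ a b c p → a * (c * (b * p)) ≡ p * (a * b * c)
    ring = solve-∀
  upper′ : ∀ y .{{_ : NonZero y}} → 1 < y → cyclo (s ∷ S) y ≤ 2 ^ (α + β) * y ^ (t * φ)
  upper′ y 1<y = *-cancelˡ-≤ (y ^ φ) {{m^n≢0 y φ}} (begin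
    y ^ φ * cyclo (s ∷ S) y                            ≤⟨ *-monoˡ-≤ (cyclo (s ∷ S) y) (lower y 1<y) ⟩
    2 ^ α * cyclo S y * cyclo (s ∷ S) y                ≡⟨ ring (2 ^ α) (cyclo S y) (cyclo (s ∷ S) y) ⟩
    2 ^ α * (cyclo (s ∷ S) y * cyclo S y)              ≡⟨ cong (2 ^ α *_) (cyclo-∷ _ S≢0 s⊥S 1<y) ⟩
    2 ^ α * cyclo S (y ^ s) {{m^n≢0 y s}}              ≤⟨ *-monoʳ-≤ (2 ^ α) (upper (y ^ s) {{m^n≢0 y s}} (1<^ s 1<y)) ⟩
    2 ^ α * (2 ^ β * (y ^ s) ^ φ)                      ≡⟨ cong (λ z → 2 ^ α * (2 ^ β * z)) (^-split y) ⟩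
    2 ^ α * (2 ^ β * (y ^ φ * y ^ (t * φ)))            ≡⟨ ring′ (2 ^ α) (2 ^ β) (y ^ φ) (y ^ (t * φ)) ⟩
    y ^ φ * (2 ^ α * 2 ^ β * y ^ (t * φ))              ≡⟨ cong (λ z → y ^ φ * (z * y ^ (t * φ))) (^-distribˡ-+-* 2 α β) ⟨
    y ^ φ * (2 ^ (α + β) * y ^ (t * φ))                ∎)
    where
    ring : ∀ a b c → a * b * c ≡ a * (c * b)
    ring = solve-∀
    ring′ : ∀ a b p r → a * (b * (p * r)) ≡ p * (a * b * r)
    ring′ = solve-∀

-- φ is Euler's function of the product of s ∷ S.  The slack α + β doubles with every new prime s,
-- but φ gets multiplied by s - 1 ≥ 2, so the last inequality persists.
cyclo-bounds : ∀ {p s S} → 2 ≤ p → All (p <_) (s ∷ S) → AllPairs Coprime (s ∷ S) →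
  ∃ λ φ → ∃ λ α → ∃ λ β → Bounds (s ∷ S) φ α β × 1 ≤ β × α + β + p ≤ 1 + φ
-- For a single prime `s` the inequality amounts to `p < s`.
cyclo-bounds {s = suc t} {[]} 2≤p (p<s ∷ []) _ = t , 0 , 1 , bounds-[s] t , s≤s z≤n , p<s
cyclo-bounds {p} {suc t} {r ∷ S} 2≤p (s≤s p≤t ∷ p<S) (s⊥S ∷ S⊥)
  with cyclo-bounds 2≤p p<S S⊥
... | φ , α , β , bounds , 1≤β , inv =
  t * φ , α + β , α + β , bounds-∷ (All.map p<⇒nonZero p<S) s⊥S bounds , ≤-trans 1≤β (m≤n+m β α) ,
  +-cancelʳ-≤ 1 _ _ (begin
    α + β + (α + β) + p + 1        ≤⟨ +-monoʳ-≤ (α + β + (α + β) + p) (≤-trans (s≤s z≤n) 2≤p) ⟩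
    α + β + (α + β) + p + p        ≡⟨ ring (α + β) p ⟩
    2 * (α + β + p)                ≤⟨ *-monoʳ-≤ 2 inv ⟩
    2 * (1 + φ)                    ≡⟨ ring′ φ ⟩
    1 + 2 * φ + 1                  ≤⟨ +-monoˡ-≤ 1 (s≤s (*-monoˡ-≤ φ (≤-trans 2≤p p≤t))) ⟩
    1 + t * φ + 1                  ∎)
  where
  open ≤-Reasoning
  p<⇒nonZero : ∀ {r} → p < r → NonZero r
  p<⇒nonZero p<r = >-nonZero (≤-<-trans z≤n p<r)
  ring : ∀ a p → a + a + p + p ≡ 2 * (a + p)
  ring = solve-∀
  ring′ : ∀ φ → 2 * (1 + φ) ≡ 1 + 2 * φ + 1
  ring′ = solve-∀

-- As `1 ≤ β`, the invariant yields `α + p ≤ φ`: the leading term absorbs the loss `2 ^ α` and still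
-- leaves `2 ^ p`, even at the smallest base 2.
cyclo-large : ∀ {p s S y} .{{_ : NonZero y}} → 2 ≤ p → All (p <_) (s ∷ S) → AllPairs Coprime (s ∷ S) →
              1 < y → 2 ^ p ≤ cyclo (s ∷ S) y
cyclo-large {p} {s} {S} {y} 2≤p p<S S⊥ 1<y with cyclo-bounds 2≤p p<S S⊥
... | φ , α , β , bounds , 1≤β , inv = *-cancelˡ-≤ (2 ^ α) {{m^n≢0 2 α}} (begin
  2 ^ α * 2 ^ p                ≡⟨ ^-distribˡ-+-* 2 α p ⟨
  2 ^ (α + p)                  ≤⟨ ^-monoʳ-≤ 2 α+p≤φ ⟩
  2 ^ φ                        ≤⟨ ^-monoˡ-≤ φ 1<y ⟩
  y ^ φ                        ≤⟨ Bounds.lower bounds y 1<y ⟩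
  2 ^ α * cyclo (s ∷ S) y      ∎)
  where
  open ≤-Reasoning
  α+p≤φ : α + p ≤ φ
  α+p≤φ = ≤-pred (begin
    1 + (α + p)   ≤⟨ +-monoˡ-≤ (α + p) 1≤β ⟩
    β + (α + p)   ≡⟨ ring α β p ⟩
    α + β + p     ≤⟨ inv ⟩
    1 + φ         ∎)
    where
    ring : ∀ α β p → β + (α + p) ≡ α + β + p
    ring = solve-∀

-- Prime factors and a large primitive divisor.

distinctPrimes-coprime : ∀ {p r} → Prime p → Prime r → p ≢ r → Coprime p r
distinctPrimes-coprime pp pr p≢r {i} (i∣p , i∣r)
  with prime⇒irreducible pp i∣p | prime⇒irreducible pr i∣r
... | inj₁ i≡1  | _         = i≡1
... | inj₂ _    | inj₁ i≡1  = i≡1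
... | inj₂ refl | inj₂ i≡r  = contradiction i≡r p≢r

-- `product primes` is to be the radical of `n`; that no prime factor is missing is supplied by
-- `distinctPrimes`. The predicate `P` carries a lower bound on the primes along.
record DistinctPrimes (P : ℕ → Set) (n : ℕ) : Set where
  field
    {cofactor}  : ℕ
    {primes}    : List ℕ
    n≡          : n ≡ cofactor * product primes
    allP        : All P primes
    pairwise    : AllPairs Coprime primes

distinctPrimes : ∀ {P : ℕ → Set} → (∀ {r} → P r → Prime r) → ∀ {ps} → All P ps →
  ∃ λ (d : DistinctPrimes P (product ps)) → ∀ {r} → r ∈ ps → r ∈ DistinctPrimes.primes d
distinctPrimes P⇒Prime [] =
  record { cofactor = 1 ; primes = [] ; n≡ = refl ; allP = [] ; pairwise = [] } , λ ()
distinctPrimes P⇒Prime {p ∷ ps} (Pp ∷ Pps) with distinctPrimes P⇒Prime Pps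
... | record { cofactor = k ; primes = S ; n≡ = eq ; allP = PS ; pairwise = S⊥ } , ps⊆S with p ∈? S
... | yes p∈S =
  record { cofactor = p * k ; primes = S ; n≡ = trans (cong (p *_) eq) (sym (*-assoc p k (product S)))
         ; allP = PS ; pairwise = S⊥ } ,
  λ { (here refl) → p∈S ; (there r∈) → ps⊆S r∈ }
... | no p∉S =
  record { cofactor = k ; primes = p ∷ S ; n≡ = trans (cong (p *_) eq) (ring p k (product S))
         ; allP = Pp ∷ PS ; pairwise = All.tabulate p⊥ ∷ S⊥ } ,
  λ { (here refl) → here refl ; (there r∈) → there (ps⊆S r∈) }
  where
  ring : ∀ p k s → p * (k * s) ≡ k * (p * s)
  ring = solve-∀
  p⊥ : ∀ {r} → r ∈ S → Coprime p r
  p⊥ r∈S = distinctPrimes-coprime (P⇒Prime Pp) (P⇒Prime (All.lookup PS r∈S)) λ { refl → p∉S r∈S }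

leastPrimeFirst : ∀ {p ps} → All Prime (p ∷ ps) →
  ∃₂ λ q rest → product (p ∷ ps) ≡ product (q ∷ rest) × Prime q × All (λ r → Prime r × q ≤ r) rest
leastPrimeFirst {p} {[]} (pp ∷ []) = p , [] , refl , pp , []
leastPrimeFirst {p} {_ ∷ _} (pp ∷ pps) with leastPrimeFirst pps
... | q , rest , eq , pq , q≤ with ≤-total p q
... | inj₁ p≤q = p , q ∷ rest , cong (p *_) eq , pp ,
  (pq , p≤q) ∷ All.map (λ (pr , q≤r) → pr , ≤-trans p≤q q≤r) q≤
... | inj₂ q≤p = q , p ∷ rest , trans (cong (p *_) eq) (ring p q (product rest)) , pq , (pp , q≤p) ∷ q≤
  where
  ring : ∀ p q s → p * (q * s) ≡ q * (p * s)
  ring = solve-∀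

evenOrOdd : ∀ n → ∃ λ h → n ≡ h * 2 ⊎ n ≡ 1 + h * 2
evenOrOdd zero    = 0 , inj₁ refl
evenOrOdd (suc n) with evenOrOdd n
... | h , inj₁ eq = h , inj₂ (cong suc eq)
... | h , inj₂ eq = suc h , inj₁ (cong suc eq)

∤2⇒odd : ∀ {n} → ¬ 2 ∣ n → ∃ λ h → n ≡ 1 + h * 2
∤2⇒odd {n} 2∤n with evenOrOdd n
... | h , inj₁ eq = contradiction (divides h eq) 2∤n
... | h , inj₂ eq = h , eq

-- Any prime factor of `n / g` will do. It reduces proper divisors to the maximal ones n / r, the
-- only exponents that enter `powLcm`.
properDivisor⇒prime : ∀ {n g} .{{_ : NonZero n}} → g ∣ n → g < n → ∃ λ r → Prime r × g * r ∣ n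
properDivisor⇒prime {n} {g} g∣n g<n with factorise (quotient g∣n) {{quotient≢0 g∣n}}
... | record { factors = [] ; isFactorisation = eq } =
  contradiction (quotient>1 g∣n g<n) (<-irrefl (sym eq))
... | record { factors = r ∷ rs ; isFactorisation = eq ; factorsPrime = pr ∷ _ } =
  r , pr , divides (product rs) (trans (m∣n⇒n≡quotient*m g∣n) (trans (cong (_* g) eq) (ring r (product rs) g)))
  where
  ring : ∀ r s g → r * s * g ≡ s * (g * r)
  ring = solve-∀

-- If n = k N with N the product of the primes dividing n, then Φₙ(M) = Φ_N(Mᵏ).
largePrimitiveDivisor : ∀ {M p r rs} → 1 < M → 2 ≤ p → All (λ s → Prime s × p < s) (r ∷ rs) →
  ∃ λ D → 2 ^ p ≤ D × Primitive M (product (r ∷ rs)) D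
largePrimitiveDivisor {M} {p} {r} {rs} 1<M 2≤p Pps with distinctPrimes proj₁ Pps
... | record { primes = [] } , ps⊆S = contradiction (ps⊆S (here refl)) λ ()
... | record { cofactor = k ; primes = s ∷ S ; n≡ = n≡ ; allP = PS ; pairwise = S⊥ } , ps⊆S =
  cyclo (s ∷ S) y , cyclo-large 2≤p (All.map proj₂ PS) S⊥ (1<^ k 1<M) , prim
  where
  n N y : ℕ
  n = product (r ∷ rs)
  N = product (s ∷ S)
  y = M ^ k
  primes = All.map proj₁ Pps
  instance
    M≢0 : NonZero M
    M≢0 = 1<⇒nonZero 1<M
    n≢0 : NonZero n
    n≢0 = productOfPrimes≢0 primes
    k≢0 : NonZero k
    k≢0 = m*n≢0⇒m≢0 k {{subst NonZero n≡ n≢0}}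
    y≢0 : NonZero y
    y≢0 = m^n≢0 M k
    M∸1≢0 : NonZero (M ∸ 1)
    M∸1≢0 = >-nonZero (m<n⇒0<n∸m 1<M)
  D : ℕ
  D = cyclo (s ∷ S) y
  -- With `g * t ∣ n` and `N = t * e`, `g` divides `k * e`, so `M ^ g ∸ 1` divides
  -- `M ^ (k * e) ∸ 1`, which is `y ^ e ∸ 1`.
  M^g∸1∣ : ∀ {g} → g ∣ n → g < n → M ^ g ∸ 1 ∣ powLcm (s ∷ S) y
  M^g∸1∣ {g} g∣n g<n with properDivisor⇒prime g∣n g<n
  ... | t , pt , g*t∣n with ∈⇒∣powLcm y (ps⊆S (factorisationHasAllPrimeFactors pt (m*n∣⇒n∣ g t g*t∣n) primes))
  ... | e , N≡ , ∣L = ∣-trans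
    (subst (λ z → M ^ g ∸ 1 ∣ z ∸ 1) (sym (^-*-assoc M k e)) (^∸1-∣ M {g} {k * e}
      (*-cancelʳ-∣ t {{prime⇒nonZero pt}} (subst (g * t ∣_) (trans n≡ (trans (cong (k *_) N≡) (ring k t e))) g*t∣n))))
    ∣L
    where
    ring : ∀ k t e → k * (t * e) ≡ k * e * t
    ring = solve-∀
  prim : Primitive M n D
  -- `D * powLcm (s ∷ S) y` is `M ^ n ∸ 1`; cancelling `M ∸ 1` passes to repunits.
  prim {g} g∣n g<n = *-cancelˡ-∣ (M ∸ 1) (subst₂ _∣_
    (trans (cong (D *_) (^∸1-via-repunit M g)) (ring D (M ∸ 1) (repunit M g)))
    (trans (sym (cyclo*powLcm (s ∷ S) y))
      (trans (cong (_∸ 1) (trans (^-*-assoc M k N) (cong (M ^_) (sym n≡)))) (^∸1-via-repunit M n)))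
    (*-monoʳ-∣ D (M^g∸1∣ g∣n g<n)))
    where
    ring : ∀ d c r → d * (c * r) ≡ c * (d * r)
    ring = solve-∀

-- Composite numbers violate the congruence.

^+1∣prodPow : ∀ x {h n} → 0 < h → h ≤ n → x ^ h + 1 ∣ prodPow x n
^+1∣prodPow x {h} {zero}  0<h h≤0 = contradiction (≤-trans 0<h h≤0) λ ()
^+1∣prodPow x {h} {suc n} 0<h h≤1+n with m≤n⇒m<n∨m≡n h≤1+n
... | inj₁ (s≤s h≤n) = ∣m⇒∣m*n _ (^+1∣prodPow x 0<h h≤n)
... | inj₂ refl      = n∣m*n (prodPow x n)

^+1∣repunit : ∀ x h → x ^ h + 1 ∣ repunit x (2 * h)
^+1∣repunit x h = subst (x ^ h + 1 ∣_)
  (trans (ring (x ^ h) (repunit x h))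
    (trans (sym (repunit-+ x h h)) (cong (λ t → repunit x (h + t)) (sym (+-identityʳ h)))))
  (m∣m*n (repunit x h))
  where
  ring : ∀ p r → (p + 1) * r ≡ r + p * r
  ring = solve-∀

even⇒repunit∤ : ∀ {M h m} .{{_ : NonZero M}} → 1 < h → suc m ≡ 2 * h → ¬ repunit M (suc m) ∣ prodPow M m ∸ 1
even⇒repunit∤ {M} {h} {m} 1<h eq ∣Q∸1 = <-irrefl (sym (∣1⇒≡1 d∣1)) (+-monoˡ-≤ 1 (m^n>0 M h))
  where
  0<h : 0 < h
  0<h = <-trans z<s 1<h
  d : ℕ
  d = M ^ h + 1
  h≤m : h ≤ m
  h≤m = ≤-pred (subst (h <_) (sym eq) (m<m+n h (subst (0 <_) (sym (+-identityʳ h)) 0<h)))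
  d∣Q∸1 : d ∣ prodPow M m ∸ 1
  d∣Q∸1 = ∣-trans (subst (λ z → d ∣ repunit M z) (sym eq) (^+1∣repunit M h)) ∣Q∸1
  d∣1 : d ∣ 1
  d∣1 = ∣m+n∣m⇒∣n (subst (d ∣_) (sym (m∸n+n≡m (prodPow>0 M m))) (^+1∣prodPow M 0<h h≤m)) d∣Q∸1

product>1 : ∀ {r rs} → All Prime (r ∷ rs) → 1 < product (r ∷ rs)
product>1 {r} {rs} (pr ∷ prs) = ≤-trans (nonTrivial⇒n>1 r {{prime⇒nonTrivial pr}})
  (m≤m*n r (product rs) {{productOfPrimes≢0 prs}})

composite⇒repunit∤ : ∀ {M q r rs m} → 1 < M → Prime q → All (λ s → Prime s × q ≤ s) (r ∷ rs) →
  suc m ≡ q * product (r ∷ rs) → ¬ repunit M (suc m) ∣ prodPow M m ∸ 1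
composite⇒repunit∤ {q = zero} 1<M pq = contradiction pq ¬prime[0]
composite⇒repunit∤ {q = suc zero} 1<M pq = contradiction pq ¬prime[1]
composite⇒repunit∤ {q = suc (suc zero)} 1<M pq Pps eq =
  even⇒repunit∤ {{1<⇒nonZero 1<M}} (product>1 (All.map proj₁ Pps)) eq
-- With `q = suc p`, the bound `q ≤ s` is literally `p < s`, as `largePrimitiveDivisor` wants it.
-- Its `D` is at least `2 ^ p` yet divides the positive number `2 ^ p ∸ 1`.
composite⇒repunit∤ {M} {suc p@(suc (suc _))} {r} {rs} {m} 1<M pq Pps eq ∣Q∸1
  with largePrimitiveDivisor {p = p} 1<M (s≤s (s≤s z≤n)) Pps | ∤2⇒odd 2∤n
  where
  2∤n : ¬ 2 ∣ product (r ∷ rs)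
  2∤n 2∣n = contradiction (proj₂ (All.lookup Pps (factorisationHasAllPrimeFactors prime[2] 2∣n (All.map proj₁ Pps))))
              λ { (s≤s (s≤s ())) }
... | D , 2^p≤D , prim | h , n≡ = <⇒≱ 2^p∸1<2^p (≤-trans 2^p≤D (∣⇒≤ {{2^p∸1≢0}} D∣2^p∸1))
  where
  n : ℕ
  n = product (r ∷ rs)
  1<n : 1 < n
  1<n = product>1 (All.map proj₁ Pps)
  instance
    M≢0 : NonZero M
    M≢0 = 1<⇒nonZero 1<M
  D∣Q∸1 : D ∣ prodPow M m ∸ 1
  D∣Q∸1 = ∣-trans (primitive⇒∣repunit 1<n prim)
    (∣-trans (subst (λ z → repunit M n ∣ repunit M z) (sym eq) (repunit-∣ M (n∣m*n (suc p)))) ∣Q∸1)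
  D∣2^p∸1 : D ∣ 2 ^ p ∸ 1
  D∣2^p∸1 = primitive⇒∣2^∸1 {h = h} (subst (1 <_) n≡ 1<n) (subst (λ z → Primitive M z D) n≡ prim) p m
    (trans eq (cong (suc p *_) n≡)) D∣Q∸1
  2^p∸1≢0 : NonZero (2 ^ p ∸ 1)
  2^p∸1≢0 = ^∸1-nonZero p (s≤s (s≤s z≤n))
  2^p∸1<2^p : 2 ^ p ∸ 1 < 2 ^ p
  2^p∸1<2^p = ≤-reflexive (trans (+-comm 1 _) (m∸n+n≡m (m^n>0 2 p)))

-- The two directions and the passage to integers.

repunit∣⇒prime : ∀ {M m} → 1 < M → 0 < m → repunit M (suc m) ∣ prodPow M m ∸ 1 → Prime (suc m)
repunit∣⇒prime {M} {m} 1<M 0<m ∣Q∸1 with factorise (suc m)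
... | record { factors = [] ; isFactorisation = eq } = contradiction (suc-injective (sym eq)) (<⇒≢ 0<m)
... | record { factors = p ∷ ps ; isFactorisation = eq ; factorsPrime = pps } with leastPrimeFirst pps
... | q , [] , eq′ , pq , [] = subst Prime (sym (trans eq (trans eq′ (*-identityʳ q)))) pq
... | q , r ∷ rs , eq′ , pq , q≤ = contradiction ∣Q∸1 (composite⇒repunit∤ 1<M pq q≤ (trans eq eq′))

prime⇒repunit∣ : ∀ {M m} .{{_ : NonZero M}} → 1 < m → Prime (suc m) → repunit M (suc m) ∣ prodPow M m ∸ 1
prime⇒repunit∣ {M} {m} 1<m pm with ∤2⇒odd 2∤
  where
  2∤ : ¬ 2 ∣ suc m
  2∤ 2∣ with prime⇒irreducible pm 2∣
  ... | inj₂ refl = <-irrefl refl 1<m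
... | h , refl = primitive⇒∣prodPow∸1 {h = h} (m<n⇒m<1+n 1<m) prim
  where
  prim : Primitive M (suc m) (repunit M (suc m))
  prim {g} g∣m g<m with prime⇒irreducible pm g∣m
  ... | inj₁ refl = ∣-reflexive (trans (cong (λ z → repunit M (suc m) * suc z) (*-zeroʳ M)) (*-identityʳ _))
  ... | inj₂ refl = contradiction g<m (<-irrefl refl)

modulus≡repunit : ∀ M m (1<M : 1 < M) → modulus M m 1<M ≡ repunit M m
modulus≡repunit M m 1<M =
  trans (cong (λ z → _/_ z (M ∸ 1) {{M∸1≢0}}) (trans (^∸1-via-repunit M {{1<⇒nonZero 1<M}} m) (*-comm (M ∸ 1) _)))
        (m*n/n≡m (repunit M m) (M ∸ 1) {{M∸1≢0}})
  where
  M∸1≢0 : NonZero (M ∸ 1)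
  M∸1≢0 = >-nonZero (m<n⇒0<n∸m 1<M)

open import Data.Integer using (+_; _-_)

theorem2 : (M : ℕ) → (1<M : 1 < M) → (m : ℕ) → 2 < m →
    Prime m ⇔ (+ modulus M m 1<M) ℤ.∣ ((+ prodPow M (m ∸ 1)) - (+ 1))
theorem2 M 1<M (suc m) (s≤s 1<m) =
  -- Divisibility of integers is divisibility of absolute values, so both directions reduce to
  -- natural numbers once the difference is seen to be nonnegative.
  mk⇔ (λ pm → subst₂ ℤ._∣_ (sym modulus≡) (sym Q-1≡) (prime⇒repunit∣ {{1<⇒nonZero 1<M}} 1<m pm))
      (λ ∣Q-1 → repunit∣⇒prime 1<M (<-trans z<s 1<m) (subst₂ ℤ._∣_ modulus≡ Q-1≡ ∣Q-1))
  where
  modulus≡ : + modulus M (suc m) 1<M ≡ + repunit M (suc m)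
  modulus≡ = cong +_ (modulus≡repunit M (suc m) 1<M)
  Q-1≡ : + prodPow M m - + 1 ≡ + (prodPow M m ∸ 1)
  Q-1≡ = trans ([+m]-[+n]≡m⊖n (prodPow M m) 1) (⊖-≥ (prodPow>0 M m))
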